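{- Let $m,L,R\ge1$ be integers and let $(p^{(r)},w^{(r)})$, $1\le r\le R$, be kernel--boundary pairs, every one of which is scalar-feasible. If $\lambda_r\ge0$ for $1\le r\le R$ and $\sum_{r=1}^R\lambda_r=1$, then \[ \sqrt{ab}\ge\min_{r:\lambda_r>0}\sqrt{a_rb_r}. \]
   Context: A kernel vector is a symmetric probability vector $p=(p_0,\ldots,p_{m-1})$ of real numbers: $p_i\ge0$, $\sum_{i=0}^{m-1}p_i=1$, $p_i=p_{m-1-i}$. A boundary vector is a real vector $w=(w_0,\ldots,w_{Lm-1})$, extended by the convention $w_j=1$ for every $j\ge Lm$. A kernel--boundary pair $(p,w)$ consists of a kernel vector and a boundary vector. The pair $(p,w)$ is scalar-feasible if \[ \sum_{i=0}^{m-1}p_iw_{q+i}\ge1\qquad\text{for all integers }0\le q\le Lm. \] For kernel--boundary pairs $(p^{(r)},w^{(r)})$, $1\le r\le R$, put \[ a_r:=m\sum_{i=0}^{m-1}\bigl(p_i^{(r)}\bigr)^2, \qquad b_r:=1+2\left(\frac1m\sum_{j=0}^{Lm-1}\bigl(w_j^{(r)}\bigr)^2-L\right). \] For weights $\lambda_1,\ldots,\lambda_R$ as in the claim, put \[ a:=m\sum_{r=1}^R\lambda_r\sum_{i=0}^{m-1}\bigl(p_i^{(r)}\bigr)^2, \qquad b:=1+2\left(\frac1m\sum_{r=1}^R\lambda_r\sum_{j=0}^{Lm-1}\bigl(w_j^{(r)}\bigr)^2-L\right). \] (Scalar feasibility implies $b_r\ge 1/m>0$, so all square roots are of nonnegative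 reals.) -}

module Defs where

open import Algebra.Bundles using (CommutativeRing; CommutativeSemiring)
open import Algebra.Core using (Op₁; Op₂)
open import Algebra.Structures using (IsCommutativeRing)
import Algebra.Definitions.RawMonoid as RawMonoidOps
import Algebra.Properties.Monoid.Sum as MonoidSum
import Algebra.Solver.Ring.NaturalCoefficients.Default as NatCoeffSolver
open import Data.Empty using (⊥-elim)
open import Data.Fin.Base using (Fin; toℕ; fromℕ<; opposite)
open import Data.Nat.Base as ℕ using (ℕ)
import Data.Nat.Properties as ℕ
open import Data.Product.Base using (∃; _×_; _,_; proj₁; proj₂)
open import Data.Sum.Base using (inj₁; inj₂)
open import Data.Vec.Functional using (Vector)
open import Level using (Level) renaming (suc to lsuc)
open import Relation.Binary.Bundles using (Poset)
open import Relation.Binary.Core using (Rel)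
open import Relation.Binary.Structures using (IsDecTotalOrder)
import Relation.Binary.Construct.NonStrictToStrict as ToStrict
import Relation.Binary.Reasoning.PartialOrder as PosetReasoning
open import Relation.Nullary.Decidable using (yes; no)
open import Relation.Nullary.Negation using (¬_)

-- The real numbers, given by the axioms that determine them up to
-- isomorphism: a Dedekind-complete totally ordered field.  As for the
-- classical reals, equality and order are decidable.  The inverse is a total
-- operation whose value at 0# is unspecified.

record RealNumbers (ℓ : Level) : Set (lsuc ℓ) where
  infix  8 _⁻¹
  infixl 7 _*_
  infixl 6 _+_
  infix  4 _≈_ _≤_
  field
    Carrier : Set ℓ
    _≈_ _≤_ : Rel Carrier ℓ
    _+_ _*_ : Op₂ Carrier
    -_ _⁻¹  : Op₁ Carrier
    0# 1#   : Carrier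

    isCommutativeRing : IsCommutativeRing _≈_ _+_ _*_ -_ 0# 1#
    0≉1               : ¬ 0# ≈ 1#
    ⁻¹-cong           : ∀ {x y} → x ≈ y → x ⁻¹ ≈ y ⁻¹
    *-inverseʳ        : ∀ {x} → ¬ x ≈ 0# → x * x ⁻¹ ≈ 1#

    isDecTotalOrder   : IsDecTotalOrder _≈_ _≤_
    +-monoˡ-≤         : ∀ {x y} z → x ≤ y → x + z ≤ y + z
    *-nonNegative     : ∀ {x y} → 0# ≤ x → 0# ≤ y → 0# ≤ x * y

  IsUpperBound : (Carrier → Set ℓ) → Carrier → Set ℓ
  IsUpperBound S u = ∀ x → S x → x ≤ u

  IsSupremum : (Carrier → Set ℓ) → Carrier → Set ℓ
  IsSupremum S s = IsUpperBound S s × (∀ u → IsUpperBound S u → s ≤ u)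

  field
    complete : (S : Carrier → Set ℓ) → ∃ S → ∃ (IsUpperBound S) →
               ∃ (IsSupremum S)

  commutativeRing : CommutativeRing ℓ ℓ
  commutativeRing = record { isCommutativeRing = isCommutativeRing }

  open CommutativeRing commutativeRing public
    using (_-_; refl; sym; trans; setoid; +-cong; +-congˡ; +-congʳ; +-assoc; +-comm;
           +-identityˡ; +-identityʳ; -‿inverseˡ; -‿inverseʳ; *-cong; *-congˡ;
           *-congʳ; *-assoc; *-comm; *-identityˡ; *-identityʳ; zeroˡ; zeroʳ;
           distribˡ; distribʳ; commutativeSemiring; +-monoid; +-rawMonoid)

  open IsDecTotalOrder isDecTotalOrder public
    using (total; antisym; _≟_; _≤?_; isPartialOrder)
    renaming (refl to ≤-refl; reflexive to ≤-reflexive; trans to ≤-trans)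

  open ToStrict _≈_ _≤_ public using (_<_)

  open MonoidSum +-monoid public using (sum; sum-syntax)

  open RawMonoidOps +-rawMonoid public using () renaming (_×_ to _·_)

  infix 9 _²
  _² : Op₁ Carrier
  x ² = x * x

  fromℕ : ℕ → Carrier
  fromℕ n = n · 1#

private
  module Identities {c ℓ} (R : CommutativeSemiring c ℓ) where
    open CommutativeSemiring R
    open NatCoeffSolver R

    id₁ : ∀ x y → (x + y) * x + y * y ≈ x * x + y * (x + y)
    id₁ = solve 2 (λ x y → (x :+ y) :* x :+ y :* y := x :* x :+ y :* (x :+ y)) refl

    id₂ : ∀ y f → y * y + f * f + f * (y + y) ≈ (y + f) * (y + f)
    id₂ = solve 2 (λ y f → y :* y :+ f :* f :+ f :* (y :+ y) := (y :+ f) :* (y :+ f)) refl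

    id₃ : ∀ o x → o * x + (o * o + o * x + x * x) ≈ (o + x) * (o + x)
    id₃ = solve 2 (λ o x → o :* x :+ (o :* o :+ o :* x :+ x :* x) := (o :+ x) :* (o :+ x)) refl

    id₄ : ∀ s e k → (s + e) * (s + e) + e * k ≈ s * s + e * (s + s + (e + k))
    id₄ = solve 3 (λ s e k → (s :+ e) :* (s :+ e) :+ e :* k
                          := s :* s :+ e :* (s :+ s :+ (e :+ k))) refl

    id₅ : ∀ s t → s * s * t + s * s * t ≈ s * ((s + s) * t)
    id₅ = solve 2 (λ s t → s :* s :* t :+ s :* s :* t := s :* ((s :+ s) :* t)) refl

    id₆ : ∀ e u → (e + u) * (e + u) + e * e ≈ e * (e + u + (e + u)) + u * u
    id₆ = solve 2 (λ e u → (e :+ u) :* (e :+ u) :+ e :* e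
                        := e :* (e :+ u :+ (e :+ u)) :+ u :* u) refl

module SquareRoot {ℓ} (ℝ : RealNumbers ℓ) where
  open RealNumbers ℝ

  private
    poset : Poset ℓ ℓ ℓ
    poset = record { isPartialOrder = isPartialOrder }

    open PosetReasoning poset
    open Identities commutativeSemiring

  +-monoʳ-≤ : ∀ {x y} z → x ≤ y → z + x ≤ z + y
  +-monoʳ-≤ {x} {y} z x≤y = begin
    z + x  ≈⟨ +-comm z x ⟩
    x + z  ≤⟨ +-monoˡ-≤ z x≤y ⟩
    y + z  ≈⟨ +-comm y z ⟩
    z + y  ∎

  x≤x+y : ∀ x {y} → 0# ≤ y → x ≤ x + y
  x≤x+y x {y} 0≤y = begin
    x       ≈⟨ +-identityʳ x ⟨
    x + 0#  ≤⟨ +-monoʳ-≤ x 0≤y ⟩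
    x + y   ∎

  x≤y+x : ∀ x {y} → 0# ≤ y → x ≤ y + x
  x≤y+x x {y} 0≤y = ≤-trans (x≤x+y x 0≤y) (≤-reflexive (+-comm x y))

  +-nonNegative : ∀ {x y} → 0# ≤ x → 0# ≤ y → 0# ≤ x + y
  +-nonNegative {x} 0≤x 0≤y = ≤-trans 0≤x (x≤x+y x 0≤y)

  x+[y-x]≈y : ∀ x y → x + (y - x) ≈ y
  x+[y-x]≈y x y = begin-equality
    x + (y - x)      ≈⟨ +-comm x (y - x) ⟩
    y + (- x) + x    ≈⟨ +-assoc y (- x) x ⟩
    y + ((- x) + x)  ≈⟨ +-congˡ (-‿inverseˡ x) ⟩
    y + 0#           ≈⟨ +-identityʳ y ⟩
    y                ∎

  x≤y⇒0≤y-x : ∀ {x y} → x ≤ y → 0# ≤ y - x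
  x≤y⇒0≤y-x {x} {y} x≤y = begin
    0#     ≈⟨ -‿inverseʳ x ⟨
    x - x  ≤⟨ +-monoˡ-≤ (- x) x≤y ⟩
    y - x  ∎

  +-cancelˡ-≤ : ∀ z {x y} → z + x ≤ z + y → x ≤ y
  +-cancelˡ-≤ z {x} {y} le = begin
    x                ≈⟨ drop x ⟨
    z + x + (- z)    ≤⟨ +-monoˡ-≤ (- z) le ⟩
    z + y + (- z)    ≈⟨ drop y ⟩
    y                ∎
    where
    drop : ∀ w → z + w + (- z) ≈ w
    drop w = trans (+-assoc z w (- z)) (x+[y-x]≈y z w)

  x+y≤x⇒y≤0 : ∀ x {y} → x + y ≤ x → y ≤ 0#
  x+y≤x⇒y≤0 x le = +-cancelˡ-≤ x (≤-trans le (≤-reflexive (sym (+-identityʳ x))))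

  *-monoˡ-≤ : ∀ {x y z} → 0# ≤ z → x ≤ y → z * x ≤ z * y
  *-monoˡ-≤ {x} {y} {z} 0≤z x≤y = begin
    z * x                ≤⟨ x≤x+y (z * x) (*-nonNegative 0≤z (x≤y⇒0≤y-x x≤y)) ⟩
    z * x + z * (y - x)  ≈⟨ distribˡ z x (y - x) ⟨
    z * (x + (y - x))    ≈⟨ *-congˡ (x+[y-x]≈y x y) ⟩
    z * y                ∎

  *-monoʳ-≤ : ∀ {x y z} → 0# ≤ z → x ≤ y → x * z ≤ y * z
  *-monoʳ-≤ {x} {y} {z} 0≤z x≤y = begin
    x * z  ≈⟨ *-comm x z ⟩
    z * x  ≤⟨ *-monoˡ-≤ 0≤z x≤y ⟩
    z * y  ≈⟨ *-comm z y ⟩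
    y * z  ∎

  x≥0∧y≤0⇒x*y≤0 : ∀ {x y} → 0# ≤ x → y ≤ 0# → x * y ≤ 0#
  x≥0∧y≤0⇒x*y≤0 {x} 0≤x y≤0 = ≤-trans (*-monoˡ-≤ 0≤x y≤0) (≤-reflexive (zeroʳ x))

  square-nonNegative : ∀ x → 0# ≤ x ²
  square-nonNegative x with total 0# x
  ... | inj₁ 0≤x = *-nonNegative 0≤x 0≤x
  ... | inj₂ x≤0 = begin
    0#                   ≤⟨ *-nonNegative 0≤-x 0≤-x ⟩
    y * y                ≈⟨ +-identityˡ (y * y) ⟨
    0# + y * y           ≈⟨ +-congʳ (zeroˡ x) ⟨
    0# * x + y * y       ≈⟨ +-congʳ (*-congʳ (x+[y-x]≈y x 0#)) ⟨
    (x + y) * x + y * y  ≈⟨ id₁ x y ⟩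
    x * x + y * (x + y)  ≈⟨ +-congˡ (*-congˡ (x+[y-x]≈y x 0#)) ⟩
    x * x + y * 0#       ≈⟨ +-congˡ (zeroʳ y) ⟩
    x * x + 0#           ≈⟨ +-identityʳ (x * x) ⟩
    x * x                ∎
    where
    y = 0# - x
    0≤-x : 0# ≤ y
    0≤-x = x≤y⇒0≤y-x x≤0

  0≤1 : 0# ≤ 1#
  0≤1 = ≤-trans (square-nonNegative 1#) (≤-reflexive (*-identityˡ 1#))

  1≰0 : ¬ 1# ≤ 0#
  1≰0 1≤0 = 0≉1 (antisym 0≤1 1≤0)

  ⁻¹-nonNegative : ∀ {x} → 0# ≤ x → ¬ x ≈ 0# → 0# ≤ x ⁻¹
  ⁻¹-nonNegative {x} 0≤x x≉0 with total 0# (x ⁻¹)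
  ... | inj₁ 0≤x⁻¹ = 0≤x⁻¹
  ... | inj₂ x⁻¹≤0 = ⊥-elim (1≰0 (≤-trans (≤-reflexive (sym (*-inverseʳ x≉0)))
                                          (x≥0∧y≤0⇒x*y≤0 0≤x x⁻¹≤0)))

  x²≤0⇒x≈0 : ∀ {x} → 0# ≤ x → x ² ≤ 0# → x ≈ 0#
  x²≤0⇒x≈0 {x} 0≤x x²≤0 with x ≟ 0#
  ... | yes x≈0 = x≈0
  ... | no  x≉0 = antisym (begin
    x               ≈⟨ *-identityʳ x ⟨
    x * 1#          ≈⟨ *-congˡ (*-inverseʳ x≉0) ⟨
    x * (x * x ⁻¹)  ≈⟨ *-assoc x x (x ⁻¹) ⟨
    x * x * x ⁻¹    ≤⟨ *-monoʳ-≤ (⁻¹-nonNegative 0≤x x≉0) x²≤0 ⟩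
    0# * x ⁻¹       ≈⟨ zeroˡ (x ⁻¹) ⟩
    0#              ∎) 0≤x

  square-cancel-≤ : ∀ {x y} → 0# ≤ y → x ² ≤ y ² → x ≤ y
  square-cancel-≤ {x} {y} 0≤y x²≤y² with total x y
  ... | inj₁ x≤y = x≤y
  ... | inj₂ y≤x = begin
    x      ≈⟨ x+[y-x]≈y y x ⟨
    y + f  ≈⟨ +-congˡ (x²≤0⇒x≈0 0≤f f²≤0) ⟩
    y + 0# ≈⟨ +-identityʳ y ⟩
    y      ∎
    where
    f = x - y
    0≤f : 0# ≤ f
    0≤f = x≤y⇒0≤y-x y≤x
    f²≤0 : f ² ≤ 0#
    f²≤0 = x+y≤x⇒y≤0 (y * y) (begin
      y * y + f * f                      ≤⟨ x≤x+y _ (*-nonNegative 0≤f (+-nonNegative 0≤y 0≤y)) ⟩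
      y * y + f * f + f * (y + y)        ≈⟨ id₂ y f ⟩
      (y + f) * (y + f)                  ≈⟨ *-cong (x+[y-x]≈y y x) (x+[y-x]≈y y x) ⟩
      x * x                              ≤⟨ x²≤y² ⟩
      y * y                              ∎)

  IsSquareRoot : Carrier → Carrier → Set ℓ
  IsSquareRoot x s = 0# ≤ s × s ² ≈ x

  square-≥ : ∀ {x s} → 0# ≤ s → (∀ y → y ² ≤ x → y ≤ s) → x ≤ s ²
  square-≥ {x} {s} 0≤s s-upper with total x (s ²)
  ... | inj₁ x≤s² = x≤s²
  ... | inj₂ s²≤x = begin
    x           ≈⟨ x+[y-x]≈y (s ²) x ⟨
    s ² + d     ≤⟨ +-monoʳ-≤ (s ²) d≤0 ⟩
    s ² + 0#    ≈⟨ +-identityʳ (s ²) ⟩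
    s ²         ∎
    where
    d = x - s ²
    0≤d = x≤y⇒0≤y-x s²≤x
    h = s + s + (1# + d)
    1≤h : 1# ≤ h
    1≤h = ≤-trans (x≤x+y 1# 0≤d) (x≤y+x (1# + d) (+-nonNegative 0≤s 0≤s))
    0≤h : 0# ≤ h
    0≤h = ≤-trans 0≤1 1≤h
    h≉0 : ¬ h ≈ 0#
    h≉0 h≈0 = 1≰0 (≤-trans 1≤h (≤-reflexive h≈0))
    0≤h⁻¹ = ⁻¹-nonNegative 0≤h h≉0
    d≤h : d ≤ h
    d≤h = ≤-trans (x≤y+x d 0≤1) (x≤y+x (1# + d) (+-nonNegative 0≤s 0≤s))
    ε = d * h ⁻¹
    0≤ε = *-nonNegative 0≤d 0≤h⁻¹
    εh≈d : ε * h ≈ d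
    εh≈d = begin-equality
      d * h ⁻¹ * h    ≈⟨ *-assoc d (h ⁻¹) h ⟩
      d * (h ⁻¹ * h)  ≈⟨ *-congˡ (trans (*-comm (h ⁻¹) h) (*-inverseʳ h≉0)) ⟩
      d * 1#          ≈⟨ *-identityʳ d ⟩
      d               ∎
    ε≤1+d : ε ≤ 1# + d
    ε≤1+d = begin
      d * h ⁻¹  ≤⟨ *-monoʳ-≤ 0≤h⁻¹ d≤h ⟩
      h * h ⁻¹  ≈⟨ *-inverseʳ h≉0 ⟩
      1#        ≤⟨ x≤x+y 1# 0≤d ⟩
      1# + d    ∎
    k = 1# + d - ε
    0≤k = x≤y⇒0≤y-x ε≤1+d
    s+ε∈S : (s + ε) ² ≤ x
    s+ε∈S = begin
      (s + ε) * (s + ε)                  ≤⟨ x≤x+y _ (*-nonNegative 0≤ε 0≤k) ⟩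
      (s + ε) * (s + ε) + ε * k          ≈⟨ id₄ s ε k ⟩
      s * s + ε * (s + s + (ε + k))      ≈⟨ +-congˡ (*-congˡ (+-congˡ (x+[y-x]≈y ε (1# + d)))) ⟩
      s * s + ε * h                      ≈⟨ +-congˡ εh≈d ⟩
      s * s + d                          ≈⟨ x+[y-x]≈y (s ²) x ⟩
      x                                  ∎
    ε≤0 : ε ≤ 0#
    ε≤0 = x+y≤x⇒y≤0 s (s-upper (s + ε) s+ε∈S)
    d≤0 : d ≤ 0#
    d≤0 = begin
      d       ≈⟨ εh≈d ⟨
      ε * h   ≤⟨ *-monoʳ-≤ 0≤h ε≤0 ⟩
      0# * h  ≈⟨ zeroˡ h ⟩
      0#      ∎

  square-≤ : ∀ {x s} → 0# ≤ x → 0# ≤ s →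
             (∀ u → (∀ y → y ² ≤ x → y ≤ u) → s ≤ u) → s ² ≤ x
  square-≤ {x} {s} 0≤x 0≤s s-least with total (s ²) x | s ≟ 0#
  ... | inj₁ s²≤x | _       = s²≤x
  ... | inj₂ _    | yes s≈0 = begin
    s * s    ≈⟨ *-congʳ s≈0 ⟩
    0# * s   ≈⟨ zeroˡ s ⟩
    0#       ≤⟨ 0≤x ⟩
    x        ∎
  ... | inj₂ x≤s² | no s≉0  = begin
    s ²          ≈⟨ x+d≈s² ⟨
    x + d        ≤⟨ +-monoʳ-≤ x d≤0 ⟩
    x + 0#       ≈⟨ +-identityʳ x ⟩
    x            ∎
    where
    d = s ² - x
    x+d≈s² : x + d ≈ s ²
    x+d≈s² = x+[y-x]≈y x (s ²)
    0≤d = x≤y⇒0≤y-x x≤s²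
    d≤s² : d ≤ s ²
    d≤s² = ≤-trans (x≤y+x d 0≤x) (≤-reflexive x+d≈s²)
    h = s + s
    0≤h = +-nonNegative 0≤s 0≤s
    h≉0 : ¬ h ≈ 0#
    h≉0 h≈0 = s≉0 (antisym (≤-trans (x≤x+y s 0≤s) (≤-reflexive h≈0)) 0≤s)
    t = h ⁻¹
    0≤t = ⁻¹-nonNegative 0≤h h≉0
    e = d * t
    0≤e = *-nonNegative 0≤d 0≤t
    eh≈d : e * h ≈ d
    eh≈d = begin-equality
      d * t * h    ≈⟨ *-assoc d t h ⟩
      d * (t * h)  ≈⟨ *-congˡ (trans (*-comm t h) (*-inverseʳ h≉0)) ⟩
      d * 1#       ≈⟨ *-identityʳ d ⟩
      d            ∎
    e≤s : e ≤ s
    e≤s = begin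
      d * t                        ≤⟨ *-monoʳ-≤ 0≤t d≤s² ⟩
      s * s * t                    ≤⟨ x≤x+y _ (*-nonNegative (square-nonNegative s) 0≤t) ⟩
      s * s * t + s * s * t        ≈⟨ id₅ s t ⟩
      s * (h * t)                  ≈⟨ *-congˡ (*-inverseʳ h≉0) ⟩
      s * 1#                       ≈⟨ *-identityʳ s ⟩
      s                            ∎
    u = s - e
    0≤u = x≤y⇒0≤y-x e≤s
    e+u≈s : e + u ≈ s
    e+u≈s = x+[y-x]≈y e s
    x≤u² : x ≤ u ²
    x≤u² = +-cancelˡ-≤ d (begin
      d + x                          ≈⟨ trans (+-comm d x) x+d≈s² ⟩
      s * s                          ≤⟨ x≤x+y (s * s) (square-nonNegative e) ⟩
      s * s + e * e                  ≈⟨ +-congʳ (*-cong e+u≈s e+u≈s) ⟨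
      (e + u) * (e + u) + e * e      ≈⟨ id₆ e u ⟩
      e * (e + u + (e + u)) + u * u  ≈⟨ +-congʳ (*-congˡ (+-cong e+u≈s e+u≈s)) ⟩
      e * h + u * u                  ≈⟨ +-congʳ eh≈d ⟩
      d + u * u                      ∎)
    s≤u : s ≤ u
    s≤u = s-least u (λ y y²≤x → square-cancel-≤ 0≤u (≤-trans y²≤x x≤u²))
    e≤0 : e ≤ 0#
    e≤0 = x+y≤x⇒y≤0 u (begin
      u + e  ≈⟨ +-comm u e ⟩
      e + u  ≈⟨ e+u≈s ⟩
      s      ≤⟨ s≤u ⟩
      u      ∎)
    d≤0 : d ≤ 0#
    d≤0 = begin
      d       ≈⟨ eh≈d ⟨
      e * h   ≤⟨ *-monoʳ-≤ 0≤h e≤0 ⟩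
      0# * h  ≈⟨ zeroˡ h ⟩
      0#      ∎

  squareRoot : ∀ {x} → 0# ≤ x → ∃ (IsSquareRoot x)
  squareRoot {x} 0≤x = s , 0≤s , antisym (square-≤ 0≤x 0≤s s-least) (square-≥ 0≤s s-upper)
    where
    S : Carrier → Set ℓ
    S y = y ² ≤ x

    0∈S : S 0#
    0∈S = ≤-trans (≤-reflexive (zeroˡ 0#)) 0≤x

    bound : IsUpperBound S (1# + x)
    bound y y²≤x = square-cancel-≤ (+-nonNegative 0≤1 0≤x) (begin
      y * y                    ≤⟨ y²≤x ⟩
      x                        ≤⟨ x≤x+y x (+-nonNegative (+-nonNegative 0≤1 0≤x) (square-nonNegative x)) ⟩
      x + (1# + x + x * x)     ≈⟨ +-congˡ (+-congʳ (+-congʳ (*-identityˡ 1#))) ⟨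
      x + (1# * 1# + x + x * x)
        ≈⟨ +-cong (*-identityˡ x) (+-congʳ (+-congˡ (*-identityˡ x))) ⟨
      1# * x + (1# * 1# + 1# * x + x * x)
        ≈⟨ id₃ 1# x ⟩
      (1# + x) * (1# + x)      ∎)

    supremum = complete S (0# , 0∈S) (1# + x , bound)
    s = proj₁ supremum
    s-upper = proj₁ (proj₂ supremum)
    s-least = proj₂ (proj₂ supremum)

    0≤s : 0# ≤ s
    0≤s = s-upper 0# 0∈S

  -- The branch for negative x is a junk value; feasible pairs never reach it.
  √ : Carrier → Carrier
  √ x with 0# ≤? x
  ... | yes 0≤x = proj₁ (squareRoot 0≤x)
  ... | no  _   = 0#

  √-isSquareRoot : ∀ {x} → 0# ≤ x → IsSquareRoot x (√ x)
  √-isSquareRoot {x} 0≤x with 0# ≤? x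
  ... | yes 0≤x′ = proj₂ (squareRoot 0≤x′)
  ... | no  0≰x  = ⊥-elim (0≰x 0≤x)

module KernelBoundary {ℓ} (ℝ : RealNumbers ℓ) where
  open RealNumbers ℝ
  open SquareRoot ℝ public using (√)

  record IsKernelVector {m : ℕ} (p : Vector Carrier m) : Set ℓ where
    field
      nonNegative : ∀ i → 0# ≤ p i
      sum≈1       : sum p ≈ 1#
      symmetric   : ∀ i → p i ≈ p (opposite i)

  record KernelBoundaryPair (m L : ℕ) : Set ℓ where
    field
      p        : Vector Carrier m
      isKernel : IsKernelVector p
      w        : Vector Carrier (L ℕ.* m)

  open KernelBoundaryPair public

  extend : ∀ {n} → Vector Carrier n → ℕ → Carrier
  extend {n} v j with j ℕ.<? n
  ... | yes j<n = v (fromℕ< j<n)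
  ... | no  _   = 1#

  module _ {m L : ℕ} where

    ScalarFeasible : KernelBoundaryPair m L → Set ℓ
    ScalarFeasible x = ∀ q → q ℕ.≤ L ℕ.* m →
      1# ≤ ∑[ i < m ] (p x i * extend (w x) (q ℕ.+ toℕ i))

    ‖p‖² ‖w‖² : KernelBoundaryPair m L → Carrier
    ‖p‖² x = ∑[ i < m ] (p x i ²)
    ‖w‖² x = ∑[ j < L ℕ.* m ] (w x j ²)

    a-value b-value : KernelBoundaryPair m L → Carrier
    a-value x = fromℕ m * ‖p‖² x
    b-value x = 1# + fromℕ 2 * (fromℕ m ⁻¹ * ‖w‖² x - fromℕ L)

    module _ {R : ℕ} (λs : Vector Carrier R)
             (x : Fin R → KernelBoundaryPair m L) where

      a-mixture b-mixture : Carrier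
      a-mixture = fromℕ m * ∑[ r < R ] (λs r * ‖p‖² (x r))
      b-mixture = 1# + fromℕ 2 *
        (fromℕ m ⁻¹ * (∑[ r < R ] (λs r * ‖w‖² (x r))) - fromℕ L)

  -- μ is the minimum of f i over the indices i satisfying P.
  IsMinimumOver : {I : Set} (P : I → Set ℓ) (f : I → Carrier) → Carrier → Set ℓ
  IsMinimumOver P f μ = (∃ λ i → P i × μ ≈ f i) × (∀ i → P i → μ ≤ f i)

{-# OPTIONS --safe #-}

-- The mixtures are the averages a = Σ λ_r a_r and b = Σ λ_r b_r, so Cauchy–Schwarz
-- gives ab ≥ (Σ λ_r √(a_r b_r))², provided that every b_r is nonnegative.  For the
-- latter put v_j = w_j²: since w ≤ (v + 1)/2, feasibility passes from w to v.
-- Adding the inequalities for q < Lm, and using that v is nonnegative with v_j = 1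
-- beyond Lm, gives Lm ≤ Σ v_j + Σ i p_i, and by symmetry the mean Σ i p_i of p is
-- at most m/2.

module Submission where

open import Defs
open import Algebra.Bundles using (CommutativeRing; CommutativeSemiring)
import Algebra.Properties.Semiring.Mult as SemiringMult
import Algebra.Properties.Semiring.Sum as SemiringSum
import Algebra.Solver.Ring.NaturalCoefficients.Default as NatCoeffSolver
open import Data.Empty using (⊥-elim)
open import Data.Fin.Base using (Fin; zero; suc; toℕ; opposite)
open import Data.Fin.Permutation using (reverse)
open import Data.Fin.Properties using (fromℕ<-toℕ; opposite-prop; toℕ<n)
open import Data.Nat.Base as ℕ using (ℕ; NonZero; z≤n; s≤s)
import Data.Nat.Properties as ℕ
open import Data.Product.Base using (∃; _×_; _,_; proj₁; proj₂)
open import Data.Sum.Base using (_⊎_; inj₁; inj₂)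
open import Data.Vec.Functional using (Vector)
open import Function.Base using (_∘_)
open import Relation.Binary.Bundles using (Poset)
import Relation.Binary.Reasoning.PartialOrder as PosetReasoning
import Relation.Binary.PropositionalEquality as ≡
open import Relation.Nullary.Decidable using (Dec; yes; no; ¬?; _×-dec_)
open import Relation.Nullary.Negation using (¬_)

-- Identities in commutative semirings.

private
  module Identities {c ℓ} (R : CommutativeSemiring c ℓ) where
    open CommutativeSemiring R
    open NatCoeffSolver R

    square-of-sum : ∀ x y → (x + y) * (x + y) ≈ x * x + y * y + (x * y + x * y)
    square-of-sum = solve 2 (λ x y → (x :+ y) :* (x :+ y)
                                  := x :* x :+ y :* y :+ (x :* y :+ x :* y)) refl

    -- This is 2xy + (x - y)² = x² + y² with x written as `y + d`, which keeps it free of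
    -- subtraction.
    square-of-difference : ∀ y d →
      (y + d) * y + (y + d) * y + d * d ≈ (y + d) * (y + d) + y * y
    square-of-difference =
      solve 2 (λ y d → (y :+ d) :* y :+ (y :+ d) :* y :+ d :* d
                    := (y :+ d) :* (y :+ d) :+ y :* y) refl

    double-product² : ∀ u v →
      (u * v + u * v) * (u * v + u * v) ≈ (u * u) * (v * v) + (u * u) * (v * v)
                                        + ((u * u) * (v * v) + (u * u) * (v * v))
    double-product² =
      solve 2 (λ u v → (u :* v :+ u :* v) :* (u :* v :+ u :* v)
                    := (u :* u) :* (v :* v) :+ (u :* u) :* (v :* v)
                       :+ ((u :* u) :* (v :* v) :+ (u :* u) :* (v :* v))) refl

    exchange : ∀ a b c d → (a * b) * (c * d) ≈ (a * d) * (c * b)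
    exchange = solve 4 (λ a b c d → (a :* b) :* (c :* d) := (a :* d) :* (c :* b)) refl

    expand : ∀ a b c d → (a + c) * (b + d) ≈ a * b + c * d + (a * d + c * b)
    expand = solve 4 (λ a b c d → (a :+ c) :* (b :+ d)
                               := a :* b :+ c :* d :+ (a :* d :+ c :* b)) refl

    -- The induction step of `sum-shift`: `eq` is the induction hypothesis, and the rest is
    -- rearrangement.
    shift-ends : ∀ a s b t e → s + a ≈ t + e → (a + s) + b ≈ (b + t) + e
    shift-ends a s b t e eq =
      trans (+-comm (a + s) b)
        (trans (+-congˡ (trans (+-comm a s) eq)) (sym (+-assoc b t e)))

    interchange : ∀ a b c d → (a + b) + (c + d) ≈ (a + c) + (b + d)
    interchange = solve 4 (λ a b c d → (a :+ b) :+ (c :+ d) := (a :+ c) :+ (b :+ d)) refl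

    -- Negation lies outside the language of semirings, so a variable `n` stands for the negative of
    -- `l`.
    regroup : ∀ l n o y →
      (l + l) + (o + ((y + n) + (y + n))) ≈ (o + (y + y)) + ((l + n) + (l + n))
    regroup = solve 4 (λ l n o y → (l :+ l) :+ (o :+ ((y :+ n) :+ (y :+ n)))
                                := (o :+ (y :+ y)) :+ ((l :+ n) :+ (l :+ n))) refl

    product-of-products : ∀ t x y → (t * x) * (t * y) ≈ (t * t) * (x * y)
    product-of-products = solve 3 (λ t x y → (t :* x) :* (t :* y)
                                          := (t :* t) :* (x :* y)) refl

    swap-factors : ∀ x y z → x * (y * z) ≈ y * (x * z)
    swap-factors = solve 3 (λ x y z → x :* (y :* z) := y :* (x :* z)) refl

    distribute : ∀ t c i x n →
      t * (c * (i * x + n)) ≈ c * (i * (t * x) + t * n)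
    distribute = solve 5 (λ t c i x n → t :* (c :* (i :* x :+ n))
                                     := c :* (i :* (t :* x) :+ t :* n)) refl

module _ {ℓ} (ℝ : RealNumbers ℓ) where
  open RealNumbers ℝ
  open SquareRoot ℝ
  open KernelBoundary ℝ using
    ( IsKernelVector; KernelBoundaryPair; p; isKernel; w; extend; ScalarFeasible
    ; ‖p‖²; ‖w‖²; a-value; b-value; a-mixture; b-mixture; IsMinimumOver )

  private
    poset : Poset ℓ ℓ ℓ
    poset = record { isPartialOrder = isPartialOrder }

    semiring = CommutativeRing.semiring commutativeRing

    open PosetReasoning poset
    open Identities commutativeSemiring
    open SemiringSum semiring
      using (sum-cong-≋; sum-cong-≗; sum-replicate; sum-replicate-zero; ∑-distrib-+; ∑-comm
            ; sum-permute; *-distribˡ-sum; *-distribʳ-sum)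
    open SemiringMult semiring using (×-homo-+; ×1-homo-*)

  -- Inequalities in an ordered field.

  +-mono-≤ : ∀ {x y u v} → x ≤ y → u ≤ v → x + u ≤ y + v
  +-mono-≤ {y = y} {u} x≤y u≤v = ≤-trans (+-monoˡ-≤ u x≤y) (+-monoʳ-≤ y u≤v)

  *-mono-≤ : ∀ {x y u v} → 0# ≤ y → 0# ≤ u → x ≤ y → u ≤ v → x * u ≤ y * v
  *-mono-≤ 0≤y 0≤u x≤y u≤v = ≤-trans (*-monoʳ-≤ 0≤u x≤y) (*-monoˡ-≤ 0≤y u≤v)

  +-cancelʳ-≤ : ∀ z {x y} → x + z ≤ y + z → x ≤ y
  +-cancelʳ-≤ z {x} {y} le = +-cancelˡ-≤ z (begin
    z + x  ≈⟨ +-comm z x ⟩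
    x + z  ≤⟨ le ⟩
    y + z  ≈⟨ +-comm y z ⟩
    z + y  ∎)

  -- The two sides differ by the square of `x - y`.
  x*y+x*y≤x²+y² : ∀ x y → x * y + x * y ≤ x ² + y ²
  x*y+x*y≤x²+y² x y = begin
    x * y + x * y                        ≤⟨ x≤x+y _ (square-nonNegative d) ⟩
    x * y + x * y + d * d                ≈⟨ +-congʳ (+-cong (*-congʳ y+d≈x) (*-congʳ y+d≈x)) ⟨
    (y + d) * y + (y + d) * y + d * d    ≈⟨ square-of-difference y d ⟩
    (y + d) * (y + d) + y * y            ≈⟨ +-congʳ (*-cong y+d≈x y+d≈x) ⟩
    x * x + y * y                        ∎
    where
    d = x - y
    y+d≈x = x+[y-x]≈y y x

  -- Both sides are squared: 4u²v² ≤ 4(ab)(cd) = 4(ad)(cb) ≤ (ad + cb)².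
  double-product-≤ : ∀ {a b c d u v} → 0# ≤ a → 0# ≤ b → 0# ≤ c → 0# ≤ d →
    u ² ≤ a * b → v ² ≤ c * d → u * v + u * v ≤ a * d + c * b
  double-product-≤ {a} {b} {c} {d} {u} {v} 0≤a 0≤b 0≤c 0≤d u²≤ab v²≤cd =
    square-cancel-≤ (+-nonNegative (*-nonNegative 0≤a 0≤d) (*-nonNegative 0≤c 0≤b)) (begin
      (u * v + u * v) * (u * v + u * v)  ≈⟨ double-product² u v ⟩
      uv + uv + (uv + uv)                ≤⟨ +-mono-≤ (+-mono-≤ uv≤rs uv≤rs) (+-mono-≤ uv≤rs uv≤rs) ⟩
      r * s + r * s + (r * s + r * s)    ≤⟨ +-monoˡ-≤ _ (x*y+x*y≤x²+y² r s) ⟩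
      r * r + s * s + (r * s + r * s)    ≈⟨ square-of-sum r s ⟨
      (r + s) * (r + s)                  ∎)
    where
    uv = (u * u) * (v * v)
    r = a * d
    s = c * b
    uv≤rs : uv ≤ r * s
    uv≤rs = begin
      (u * u) * (v * v)  ≤⟨ *-mono-≤ (*-nonNegative 0≤a 0≤b) (square-nonNegative v) u²≤ab v²≤cd ⟩
      (a * b) * (c * d)  ≈⟨ exchange a b c d ⟩
      (a * d) * (c * b)  ∎

  -- Finite sums and the Cauchy-Schwarz inequality.

  sum-mono-≤ : ∀ {n} {f g : Vector Carrier n} → (∀ i → f i ≤ g i) → sum f ≤ sum g
  sum-mono-≤ {ℕ.zero}  f≤g = ≤-refl
  sum-mono-≤ {ℕ.suc n} f≤g = +-mono-≤ (f≤g zero) (sum-mono-≤ (f≤g ∘ suc))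

  sum-nonNegative : ∀ {n} {f : Vector Carrier n} → (∀ i → 0# ≤ f i) → 0# ≤ sum f
  sum-nonNegative {n} {f} 0≤f = begin
    0#                 ≈⟨ sum-replicate-zero n ⟨
    ∑[ i < n ] 0#      ≤⟨ sum-mono-≤ 0≤f ⟩
    sum f              ∎

  -- Bounding `h i ²` by `f i * g i` avoids taking square roots of `f` and `g`. In the induction the
  -- squares are bounded by the hypothesis and the induction hypothesis, the cross terms by
  -- `double-product-≤`.
  cauchySchwarz : ∀ {n} (f g h : Vector Carrier n) →
    (∀ i → 0# ≤ f i) → (∀ i → 0# ≤ g i) → (∀ i → h i ² ≤ f i * g i) →
    sum h ² ≤ sum f * sum g
  cauchySchwarz {ℕ.zero}  f g h 0≤f 0≤g h²≤fg = ≤-refl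
  cauchySchwarz {ℕ.suc n} f g h 0≤f 0≤g h²≤fg = begin
    (u + v) * (u + v)                  ≈⟨ square-of-sum u v ⟩
    u * u + v * v + (u * v + u * v)    ≤⟨ +-mono-≤ (+-mono-≤ (h²≤fg zero) ih)
                                            (double-product-≤ (0≤f zero) (0≤g zero)
                                              (sum-nonNegative (0≤f ∘ suc))
                                              (sum-nonNegative (0≤g ∘ suc))
                                              (h²≤fg zero) ih) ⟩
    a * b + c * d + (a * d + c * b)    ≈⟨ expand a b c d ⟨
    (a + c) * (b + d)                  ∎
    where
    a = f zero
    b = g zero
    c = sum (f ∘ suc)
    d = sum (g ∘ suc)
    u = h zero
    v = sum (h ∘ suc)
    ih : v ² ≤ c * d
    ih = cauchySchwarz (f ∘ suc) (g ∘ suc) (h ∘ suc) (0≤f ∘ suc) (0≤g ∘ suc) (h²≤fg ∘ suc)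

  -- Natural numbers as reals.

  fromℕ-nonNegative : ∀ n → 0# ≤ fromℕ n
  fromℕ-nonNegative ℕ.zero    = ≤-refl
  fromℕ-nonNegative (ℕ.suc n) = +-nonNegative 0≤1 (fromℕ-nonNegative n)

  fromℕ-mono-≤ : ∀ {i j} → i ℕ.≤ j → fromℕ i ≤ fromℕ j
  fromℕ-mono-≤ {j = j} z≤n = fromℕ-nonNegative j
  fromℕ-mono-≤ (s≤s i≤j)   = +-monoʳ-≤ 1# (fromℕ-mono-≤ i≤j)

  fromℕ≉0 : ∀ n .{{_ : NonZero n}} → ¬ fromℕ n ≈ 0#
  fromℕ≉0 (ℕ.suc n) n≈0 = 1≰0 (≤-trans (x≤x+y 1# (fromℕ-nonNegative n)) (≤-reflexive n≈0))

  fromℕ2*x≈x+x : ∀ x → fromℕ 2 * x ≈ x + x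
  fromℕ2*x≈x+x x = begin-equality
    (1# + (1# + 0#)) * x  ≈⟨ *-congʳ (+-congˡ (+-identityʳ 1#)) ⟩
    (1# + 1#) * x         ≈⟨ distribʳ x 1# 1# ⟩
    1# * x + 1# * x       ≈⟨ +-cong (*-identityˡ x) (*-identityˡ x) ⟩
    x + x                 ∎

  -- Sums over sliding windows.

  -- Both sides are the sum of `g` over 0, ..., n, with the first or the last term split off.
  sum-shift : ∀ n (g : ℕ → Carrier) →
    ∑[ j < n ] g (ℕ.suc (toℕ j)) + g 0 ≈ ∑[ j < n ] g (toℕ j) + g n
  sum-shift ℕ.zero    g = refl
  sum-shift (ℕ.suc n) g =
    shift-ends (g 1) (∑[ j < n ] g (2 ℕ.+ toℕ j)) (g 0) (∑[ j < n ] g (1 ℕ.+ toℕ j)) (g (ℕ.suc n))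
      (sum-shift n (g ∘ ℕ.suc))

  module _ {n} {g : ℕ → Carrier} (0≤g : ∀ j → 0# ≤ g j) (g≈1 : ∀ {j} → n ℕ.≤ j → g j ≈ 1#) where

    -- Moving the window from `k` to `k + 1` drops the nonnegative term `g k` and gains `g (n + k)`,
    -- which is 1. So each step raises the sum by at most 1.
    window-sum-≤ : ∀ k → ∑[ j < n ] g (toℕ j ℕ.+ k) ≤ ∑[ j < n ] g (toℕ j) + fromℕ k
    window-sum-≤ ℕ.zero = begin
      ∑[ j < n ] g (toℕ j ℕ.+ 0)  ≡⟨ sum-cong-≗ {n} (λ j → ≡.cong g (ℕ.+-identityʳ (toℕ j))) ⟩
      ∑[ j < n ] g (toℕ j)        ≈⟨ +-identityʳ _ ⟨
      ∑[ j < n ] g (toℕ j) + 0#   ∎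
    window-sum-≤ (ℕ.suc k) = begin
      ∑[ j < n ] g (toℕ j ℕ.+ ℕ.suc k)            ≡⟨ sum-cong-≗ {n} (λ j → ≡.cong g (ℕ.+-suc (toℕ j) k)) ⟩
      ∑[ j < n ] g (ℕ.suc (toℕ j) ℕ.+ k)          ≤⟨ x≤x+y _ (0≤g k) ⟩
      ∑[ j < n ] g (ℕ.suc (toℕ j) ℕ.+ k) + g k    ≈⟨ sum-shift n (λ j → g (j ℕ.+ k)) ⟩
      ∑[ j < n ] g (toℕ j ℕ.+ k) + g (n ℕ.+ k)    ≤⟨ +-mono-≤ (window-sum-≤ k) (≤-reflexive (g≈1 (ℕ.m≤m+n n k))) ⟩
      ∑[ j < n ] g (toℕ j) + fromℕ k + 1#         ≈⟨ +-assoc _ _ _ ⟩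
      ∑[ j < n ] g (toℕ j) + (fromℕ k + 1#)       ≈⟨ +-congˡ (+-comm _ _) ⟩
      ∑[ j < n ] g (toℕ j) + fromℕ (ℕ.suc k)      ∎

  -- The extension of a boundary vector.

  extend-toℕ : ∀ {n} (v : Vector Carrier n) j → extend v (toℕ j) ≈ v j
  extend-toℕ {n} v j with toℕ j ℕ.<? n
  ... | yes j<n = CommutativeRing.reflexive commutativeRing (≡.cong v (fromℕ<-toℕ j j<n))
  ... | no  j≮n = ⊥-elim (j≮n (toℕ<n j))

  extend-≥ : ∀ {n} (v : Vector Carrier n) {j} → n ℕ.≤ j → extend v j ≈ 1#
  extend-≥ {n} v {j} n≤j with j ℕ.<? n
  ... | yes j<n = ⊥-elim (ℕ.<⇒≱ j<n n≤j)
  ... | no  _   = refl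

  -- The sum is exactly m - 1. Replacing `i` by `i + 1` makes the truncated subtraction in
  -- `opposite-prop` cancel; the resulting bound m suffices for b ≥ 0, while m - 1 would give b ≥
  -- 1/m.
  toℕ+toℕ-opposite≤ : ∀ {m} (i : Fin m) → toℕ i ℕ.+ toℕ (opposite i) ℕ.≤ m
  toℕ+toℕ-opposite≤ {m} i = ℕ.≤-trans
    (ℕ.+-mono-≤ (ℕ.n≤1+n (toℕ i)) (ℕ.≤-reflexive (opposite-prop i)))
    (ℕ.≤-reflexive (ℕ.m+[n∸m]≡n (toℕ<n i)))

  -- Averages against a kernel vector.

  module _ {m} {p : Vector Carrier m} (isKernel : IsKernelVector p) where
    open IsKernelVector isKernel

    sum-scaled : ∀ c → ∑[ i < m ] (p i * c) ≈ c
    sum-scaled c = begin-equality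
      ∑[ i < m ] (p i * c)  ≈⟨ *-distribʳ-sum c p ⟨
      sum p * c             ≈⟨ *-congʳ sum≈1 ⟩
      1# * c                ≈⟨ *-identityˡ c ⟩
      c                     ∎

    kernel-mean : Carrier
    kernel-mean = ∑[ i < m ] (p i * fromℕ (toℕ i))

    -- Reverse the order of summation in one copy of the mean and use the symmetry of `p`: then
    -- `p i` multiplies the sum of `i` and its opposite, which is at most m.
    kernel-mean-≤ : kernel-mean + kernel-mean ≤ fromℕ m
    kernel-mean-≤ = begin
      kernel-mean + kernel-mean
        ≈⟨ +-congˡ (sum-permute f reverse) ⟩
      kernel-mean + ∑[ i < m ] (p (opposite i) * fromℕ (toℕ (opposite i)))
        ≈⟨ +-congˡ (sum-cong-≋ {m} (λ i → *-congʳ (symmetric i))) ⟨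
      kernel-mean + ∑[ i < m ] (p i * fromℕ (toℕ (opposite i)))
        ≈⟨ ∑-distrib-+ f (λ i → p i * fromℕ (toℕ (opposite i))) ⟨
      ∑[ i < m ] (p i * fromℕ (toℕ i) + p i * fromℕ (toℕ (opposite i)))
        ≤⟨ sum-mono-≤ termwise ⟩
      ∑[ i < m ] (p i * fromℕ m)
        ≈⟨ sum-scaled (fromℕ m) ⟩
      fromℕ m ∎
      where
      f : Vector Carrier m
      f i = p i * fromℕ (toℕ i)
      termwise : ∀ i → p i * fromℕ (toℕ i) + p i * fromℕ (toℕ (opposite i)) ≤ p i * fromℕ m
      termwise i = begin
        p i * fromℕ (toℕ i) + p i * fromℕ (toℕ (opposite i))  ≈⟨ distribˡ _ _ _ ⟨
        p i * (fromℕ (toℕ i) + fromℕ (toℕ (opposite i)))      ≈⟨ *-congˡ (×-homo-+ 1# (toℕ i) (toℕ (opposite i))) ⟨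
        p i * fromℕ (toℕ i ℕ.+ toℕ (opposite i))
          ≤⟨ *-monoˡ-≤ (nonNegative i) (fromℕ-mono-≤ (toℕ+toℕ-opposite≤ i)) ⟩
        p i * fromℕ m                                         ∎

    -- Averaging 2y ≤ y² + 1 against `p` gives 2 ≤ 2 Σ p y ≤ Σ p y² + 1. This carries feasibility
    -- over from w to its squares.
    average-of-squares-≥1 : (y : Vector Carrier m) →
      1# ≤ ∑[ i < m ] (p i * y i) → 1# ≤ ∑[ i < m ] (p i * y i ²)
    average-of-squares-≥1 y 1≤py = +-cancelʳ-≤ 1# (begin
      1# + 1#                                            ≤⟨ +-mono-≤ 1≤py 1≤py ⟩
      sum py + sum py                                    ≈⟨ ∑-distrib-+ py py ⟨
      ∑[ i < m ] (p i * y i + p i * y i)                 ≤⟨ sum-mono-≤ termwise ⟩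
      ∑[ i < m ] (p i * y i ² + p i * 1#)                ≈⟨ ∑-distrib-+ _ (λ i → p i * 1#) ⟩
      ∑[ i < m ] (p i * y i ²) + ∑[ i < m ] (p i * 1#)   ≈⟨ +-congˡ (sum-scaled 1#) ⟩
      ∑[ i < m ] (p i * y i ²) + 1#                      ∎)
      where
      py : Vector Carrier m
      py i = p i * y i
      y+y≤y²+1 : ∀ x → x + x ≤ x ² + 1#
      y+y≤y²+1 x = begin
        x + x              ≈⟨ +-cong (*-identityʳ x) (*-identityʳ x) ⟨
        x * 1# + x * 1#    ≤⟨ x*y+x*y≤x²+y² x 1# ⟩
        x ² + 1# ²         ≈⟨ +-congˡ (*-identityʳ 1#) ⟩
        x ² + 1#           ∎
      termwise : ∀ i → p i * y i + p i * y i ≤ p i * y i ² + p i * 1#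
      termwise i = begin
        p i * y i + p i * y i      ≈⟨ distribˡ _ _ _ ⟨
        p i * (y i + y i)          ≤⟨ *-monoˡ-≤ (nonNegative i) (y+y≤y²+1 (y i)) ⟩
        p i * (y i ² + 1#)         ≈⟨ distribˡ _ _ _ ⟩
        p i * y i ² + p i * 1#     ∎

  -- Nonnegativity of a and b for a single pair.

  module _ {m L : ℕ} (x : KernelBoundaryPair m L) where
    open IsKernelVector (isKernel x)

    private
      N = L ℕ.* m
      mean = kernel-mean (isKernel x)

      v : ℕ → Carrier
      v j = extend (w x) j ²

    sum-extend² : ∑[ j < N ] v (toℕ j) ≈ ‖w‖² x
    sum-extend² = sum-cong-≋ {N} (λ j → *-cong (extend-toℕ (w x) j) (extend-toℕ (w x) j))

    extend²-≥ : ∀ {j} → N ℕ.≤ j → v j ≈ 1#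
    extend²-≥ N≤j = trans (*-cong (extend-≥ (w x) N≤j) (extend-≥ (w x) N≤j)) (*-identityʳ 1#)

    -- Add the N inequalities for the squares. After exchanging the sums, `p i` multiplies a window
    -- sum of `v` starting at `i`.
    feasible⇒‖w‖²-bound : ScalarFeasible x → fromℕ N ≤ ‖w‖² x + mean
    feasible⇒‖w‖²-bound feasible = begin
      fromℕ N
        ≈⟨ sum-replicate N ⟨
      ∑[ q < N ] 1#
        ≤⟨ sum-mono-≤ {N} (λ q → average-of-squares-≥1 (isKernel x)
             (λ i → extend (w x) (toℕ q ℕ.+ toℕ i))
             (feasible (toℕ q) (ℕ.<⇒≤ (toℕ<n q)))) ⟩
      ∑[ q < N ] ∑[ i < m ] (p x i * v (toℕ q ℕ.+ toℕ i))
        ≈⟨ ∑-comm {N} {m} (λ q i → p x i * v (toℕ q ℕ.+ toℕ i)) ⟩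
      ∑[ i < m ] ∑[ q < N ] (p x i * v (toℕ q ℕ.+ toℕ i))
        ≈⟨ sum-cong-≋ {m} (λ i → *-distribˡ-sum (p x i) (λ (q : Fin N) → v (toℕ q ℕ.+ toℕ i))) ⟨
      ∑[ i < m ] (p x i * ∑[ q < N ] v (toℕ q ℕ.+ toℕ i))
        -- The window starting at `i` exceeds the one starting at 0 by at most `i`; averaged against
        -- `p`, these excesses become `mean`.
        ≤⟨ sum-mono-≤ {m} (λ i → *-monoˡ-≤ (nonNegative i)
             (window-sum-≤ {N} {v} (λ j → square-nonNegative _) extend²-≥ (toℕ i))) ⟩
      ∑[ i < m ] (p x i * (∑[ j < N ] v (toℕ j) + fromℕ (toℕ i)))
        ≈⟨ sum-cong-≋ {m} (λ i → trans (*-congˡ (+-congʳ sum-extend²)) (distribˡ _ _ _)) ⟩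
      ∑[ i < m ] (p x i * ‖w‖² x + p x i * fromℕ (toℕ i))
        ≈⟨ ∑-distrib-+ {m} (λ i → p x i * ‖w‖² x) (λ i → p x i * fromℕ (toℕ i)) ⟩
      ∑[ i < m ] (p x i * ‖w‖² x) + mean
        ≈⟨ +-congʳ (sum-scaled (isKernel x) (‖w‖² x)) ⟩
      ‖w‖² x + mean ∎

    a-value-nonNegative : 0# ≤ a-value x
    a-value-nonNegative = *-nonNegative (fromℕ-nonNegative m)
      (sum-nonNegative {m} (λ i → square-nonNegative (p x i)))

    -- Doubling the bound on `‖w‖²` and using 2 `mean` ≤ m gives 2Lm ≤ m + 2W; it remains to divide
    -- by m.
    b-value-nonNegative : .{{_ : NonZero m}} → ScalarFeasible x → 0# ≤ b-value x
    -- Adding 2L to both sides turns the goal into 2L ≤ 1 + 2W/m, without subtraction.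
    b-value-nonNegative feasible = +-cancelˡ-≤ (l + l) (begin
      l + l + 0#                               ≈⟨ +-identityʳ _ ⟩
      l + l                                    ≈⟨ +-cong J[lM]≈l J[lM]≈l ⟨
      J * (l * M) + J * (l * M)                ≈⟨ distribˡ _ _ _ ⟨
      J * (l * M + l * M)                      ≤⟨ *-monoˡ-≤ 0≤J lM+lM≤ ⟩
      J * (M + (W + W))                        ≈⟨ distribˡ _ _ _ ⟩
      J * M + J * (W + W)                      ≈⟨ +-cong JM≈1 (distribˡ _ _ _) ⟩
      1# + (J * W + J * W)                     ≈⟨ +-identityʳ _ ⟨
      1# + (J * W + J * W) + 0#                ≈⟨ +-congˡ (trans (+-cong l-l≈0 l-l≈0) (+-identityʳ 0#)) ⟨
      1# + (J * W + J * W) + ((l - l) + (l - l))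
                                               ≈⟨ regroup l (- l) 1# (J * W) ⟨
      l + l + (1# + ((J * W - l) + (J * W - l)))
                                               ≈⟨ +-congˡ (+-congˡ (fromℕ2*x≈x+x (J * W - l))) ⟨
      l + l + b-value x                        ∎)
      where
      M = fromℕ m
      J = M ⁻¹
      l = fromℕ L
      W = ‖w‖² x
      l-l≈0 = -‿inverseʳ l
      0≤J : 0# ≤ J
      0≤J = ⁻¹-nonNegative (fromℕ-nonNegative m) (fromℕ≉0 m)
      JM≈1 : J * M ≈ 1#
      JM≈1 = trans (*-comm J M) (*-inverseʳ (fromℕ≉0 m))
      J[lM]≈l : J * (l * M) ≈ l
      J[lM]≈l = trans (swap-factors J l M) (trans (*-congˡ JM≈1) (*-identityʳ l))
      lM≤ : l * M ≤ W + mean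
      lM≤ = ≤-trans (≤-reflexive (sym (×1-homo-* L m))) (feasible⇒‖w‖²-bound feasible)
      lM+lM≤ : l * M + l * M ≤ M + (W + W)
      lM+lM≤ = begin
        l * M + l * M                  ≤⟨ +-mono-≤ lM≤ lM≤ ⟩
        (W + mean) + (W + mean)        ≈⟨ interchange W mean W mean ⟩
        (W + W) + (mean + mean)        ≤⟨ +-monoʳ-≤ (W + W) (kernel-mean-≤ (isKernel x)) ⟩
        (W + W) + M                    ≈⟨ +-comm (W + W) M ⟩
        M + (W + W)                    ∎

  -- The mixtures as weighted averages.

  module _ {m L R : ℕ} (λs : Vector Carrier R) (x : Fin R → KernelBoundaryPair m L) where

    a-mixture-average : ∑[ r < R ] (λs r * a-value (x r)) ≈ a-mixture λs x
    a-mixture-average = begin-equality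
      ∑[ r < R ] (λs r * (fromℕ m * ‖p‖² (x r)))
        ≈⟨ sum-cong-≋ {R} (λ r → swap-factors (λs r) (fromℕ m) (‖p‖² (x r))) ⟩
      ∑[ r < R ] (fromℕ m * (λs r * ‖p‖² (x r)))
        ≈⟨ *-distribˡ-sum (fromℕ m) (λ r → λs r * ‖p‖² (x r)) ⟨
      a-mixture λs x ∎

    -- Unlike `a-value`, `b-value` is only affine in the squared norm: its constants 1 and -L are
    -- preserved because the weights sum to 1.
    b-mixture-average : sum λs ≈ 1# → ∑[ r < R ] (λs r * b-value (x r)) ≈ b-mixture λs x
    b-mixture-average Σλ≈1 = begin-equality
      ∑[ r < R ] (λs r * b-value (x r))
        ≈⟨ sum-cong-≋ {R} (λ r → trans (distribˡ _ _ _)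
             (+-cong (*-identityʳ (λs r)) (distribute (λs r) c J (‖w‖² (x r)) n))) ⟩
      ∑[ r < R ] (λs r + c * (J * λW r + λs r * n))
        ≈⟨ ∑-distrib-+ λs (λ r → c * (J * λW r + λs r * n)) ⟩
      sum λs + ∑[ r < R ] (c * (J * λW r + λs r * n))
        ≈⟨ +-cong Σλ≈1 (sym (*-distribˡ-sum c (λ r → J * λW r + λs r * n))) ⟩
      1# + c * ∑[ r < R ] (J * λW r + λs r * n)
        ≈⟨ +-congˡ (*-congˡ (∑-distrib-+ (λ r → J * λW r) (λ r → λs r * n))) ⟩
      1# + c * (∑[ r < R ] (J * λW r) + ∑[ r < R ] (λs r * n))
        ≈⟨ +-congˡ (*-congˡ (+-cong (*-distribˡ-sum J λW) (*-distribʳ-sum n λs))) ⟨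
      1# + c * (J * sum λW + sum λs * n)
        ≈⟨ +-congˡ (*-congˡ (+-congˡ (trans (*-congʳ Σλ≈1) (*-identityˡ n)))) ⟩
      b-mixture λs x ∎
      where
      c = fromℕ 2
      J = fromℕ m ⁻¹
      n = - fromℕ L
      λW : Vector Carrier R
      λW r = λs r * ‖w‖² (x r)

  -- Minima over decidable sets of indices.

  minimum : ∀ {n} {P : Fin n → Set ℓ} → (∀ i → Dec (P i)) → (f : Vector Carrier n) →
    (∀ i → ¬ P i) ⊎ ∃ (IsMinimumOver P f)
  minimum {ℕ.zero}  P? f = inj₁ λ ()
  minimum {ℕ.suc n} P? f with P? zero | minimum (P? ∘ suc) (f ∘ suc)
  ... | no ¬P₀ | inj₁ none = inj₁ λ { zero → ¬P₀ ; (suc i) → none i }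
  ... | no ¬P₀ | inj₂ (μ , (i , Pi , μ≈fi) , lower) =
    inj₂ (μ , (suc i , Pi , μ≈fi) , λ { zero P₀ → ⊥-elim (¬P₀ P₀) ; (suc j) → lower j })
  ... | yes P₀ | inj₁ none =
    inj₂ (f zero , (zero , P₀ , refl) ,
          λ { zero _ → ≤-refl ; (suc j) Pj → ⊥-elim (none j Pj) })
  ... | yes P₀ | inj₂ (μ , (i , Pi , μ≈fi) , lower) with total (f zero) μ
  ...   | inj₁ f₀≤μ =
    inj₂ (f zero , (zero , P₀ , refl) ,
          λ { zero _ → ≤-refl ; (suc j) Pj → ≤-trans f₀≤μ (lower j Pj) })
  ...   | inj₂ μ≤f₀ =
    inj₂ (μ , (suc i , Pi , μ≈fi) , λ { zero _ → μ≤f₀ ; (suc j) → lower j })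

  0<?_ : ∀ y → Dec (0# < y)
  0<? y = (0# ≤? y) ×-dec ¬? (0# ≟ y)

  -- Comparison with square roots, and the averaged product.

  ≤-√ : ∀ {μ y} → 0# ≤ y → μ ² ≤ y → μ ≤ √ y
  ≤-√ 0≤y μ²≤y = square-cancel-≤ (proj₁ root) (≤-trans μ²≤y (≤-reflexive (sym (proj₂ root))))
    where root = √-isSquareRoot 0≤y

  ≤√⇒²≤ : ∀ {μ y} → 0# ≤ μ → 0# ≤ y → μ ≤ √ y → μ ² ≤ y
  ≤√⇒²≤ 0≤μ 0≤y μ≤√y =
    ≤-trans (*-mono-≤ (proj₁ root) 0≤μ μ≤√y μ≤√y) (≤-reflexive (proj₂ root))
    where root = √-isSquareRoot 0≤y

  -- Cauchy-Schwarz with the constant `μ` in place of each root: the weights sum to 1, so the sum of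
  -- the `λs r * μ` is `μ`.
  average-product-≥ : ∀ {R} (λs a b : Vector Carrier R) {μ} →
    (∀ r → 0# ≤ λs r) → sum λs ≈ 1# → (∀ r → 0# ≤ a r) → (∀ r → 0# ≤ b r) →
    (∀ r → 0# < λs r → μ ² ≤ a r * b r) →
    μ ² ≤ ∑[ r < R ] (λs r * a r) * ∑[ r < R ] (λs r * b r)
  average-product-≥ {R} λs a b {μ} 0≤λ Σλ≈1 0≤a 0≤b μ²≤ab = begin
    μ * μ                                              ≈⟨ *-cong Σλμ≈μ Σλμ≈μ ⟨
    (∑[ r < R ] (λs r * μ)) ²                          ≤⟨ cauchySchwarz λa λb (λ r → λs r * μ)
                                                            (λ r → *-nonNegative (0≤λ r) (0≤a r))
                                                            (λ r → *-nonNegative (0≤λ r) (0≤b r))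
                                                            termwise ⟩
    sum λa * sum λb                                    ∎
    where
    λa λb : Vector Carrier R
    λa r = λs r * a r
    λb r = λs r * b r
    Σλμ≈μ : ∑[ r < R ] (λs r * μ) ≈ μ
    Σλμ≈μ = trans (sym (*-distribʳ-sum μ λs)) (trans (*-congʳ Σλ≈1) (*-identityˡ μ))
    λ²μ²≤λ²ab : ∀ r → (λs r * λs r) * (μ * μ) ≤ (λs r * λs r) * (a r * b r)
    λ²μ²≤λ²ab r with 0<? λs r
    ... | yes 0<λ = *-monoˡ-≤ (square-nonNegative (λs r)) (μ²≤ab r 0<λ)
    ... | no  0≮λ with 0# ≟ λs r
    ...   | no  0≉λ = ⊥-elim (0≮λ (0≤λ r , 0≉λ))
    -- At weight zero `μ ²` may exceed `a r * b r`, but the factor `λs r * λs r` makes both sides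
    -- vanish.
    ...   | yes 0≈λ = ≤-reflexive (trans (vanish (μ * μ)) (sym (vanish (a r * b r))))
      where
      vanish : ∀ z → (λs r * λs r) * z ≈ 0#
      vanish z = trans (*-congʳ (trans (*-congʳ (sym 0≈λ)) (zeroˡ _))) (zeroˡ z)
    termwise : ∀ r → (λs r * μ) ² ≤ λa r * λb r
    termwise r = begin
      (λs r * μ) * (λs r * μ)            ≈⟨ product-of-products (λs r) μ μ ⟩
      (λs r * λs r) * (μ * μ)            ≤⟨ λ²μ²≤λ²ab r ⟩
      (λs r * λs r) * (a r * b r)        ≈⟨ product-of-products (λs r) (a r) (b r) ⟨
      (λs r * a r) * (λs r * b r)        ∎

  -- Otherwise all weights would be 0, and so would their sum. Hence the minimum in the theorem
  -- ranges over a nonempty set.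
  some-positive : ∀ {R} (λs : Vector Carrier R) → (∀ r → 0# ≤ λs r) → sum λs ≈ 1# →
    ¬ (∀ r → ¬ 0# < λs r)
  some-positive {R} λs 0≤λ Σλ≈1 none = 1≰0 (begin
    1#               ≈⟨ Σλ≈1 ⟨
    sum λs           ≤⟨ sum-mono-≤ λ≤0 ⟩
    ∑[ r < R ] 0#    ≈⟨ sum-replicate-zero R ⟩
    0#               ∎)
    where
    λ≤0 : ∀ r → λs r ≤ 0#
    λ≤0 r with 0# ≟ λs r
    ... | yes 0≈λ = ≤-reflexive (sym 0≈λ)
    ... | no  0≉λ = ⊥-elim (none r (0≤λ r , 0≉λ))

proposition2p2 :
  ∀ {ℓ} (ℝ : RealNumbers ℓ) →
  let open RealNumbers ℝ
      open KernelBoundary ℝ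
  in
  (m L R : ℕ) .{{_ : NonZero m}} .{{_ : NonZero L}} .{{_ : NonZero R}} →
  (x : Fin R → KernelBoundaryPair m L) →
  (∀ r → ScalarFeasible (x r)) →
  (λs : Vector Carrier R) →
  (∀ r → 0# ≤ λs r) →
  sum λs ≈ 1# →
  ∃ λ μ →
    IsMinimumOver (λ r → 0# < λs r) (λ r → √ (a-value (x r) * b-value (x r))) μ
    × μ ≤ √ (a-mixture λs x * b-mixture λs x)
proposition2p2 ℝ m L R x feasible λs 0≤λ Σλ≈1 =
  μ , isMinimum , ≤-√ ℝ 0≤ab μ²≤ab
  where
  open RealNumbers ℝ
  open SquareRoot ℝ
  open KernelBoundary ℝ using (a-value; b-value; a-mixture; b-mixture; IsMinimumOver)

  a b : Vector Carrier R
  a r = a-value (x r)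
  b r = b-value (x r)

  0≤a : ∀ r → 0# ≤ a r
  0≤a r = a-value-nonNegative ℝ (x r)

  0≤b : ∀ r → 0# ≤ b r
  0≤b r = b-value-nonNegative ℝ (x r) (feasible r)

  smallest : ∃ (IsMinimumOver (λ r → 0# < λs r) (λ r → √ (a r * b r)))
  smallest with minimum ℝ (λ r → 0<?_ ℝ (λs r)) (λ r → √ (a r * b r))
  ... | inj₁ none  = ⊥-elim (some-positive ℝ λs 0≤λ Σλ≈1 none)
  ... | inj₂ found = found

  μ = proj₁ smallest
  isMinimum = proj₂ smallest

  0≤a*b : ∀ r → 0# ≤ a r * b r
  0≤a*b r = *-nonNegative (0≤a r) (0≤b r)

  -- The minimum is attained, so `μ` is itself one of the roots. Its sign is what permits squaring
  -- `μ ≤ √ (a r * b r)`.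
  0≤μ : 0# ≤ μ
  0≤μ with r , _ , μ≈√ ← proj₁ isMinimum =
    ≤-trans (proj₁ (√-isSquareRoot (0≤a*b r))) (≤-reflexive (sym μ≈√))

  μ²≤ab : μ ² ≤ a-mixture λs x * b-mixture λs x
  μ²≤ab = ≤-trans
    (average-product-≥ ℝ λs a b 0≤λ Σλ≈1 0≤a 0≤b
      (λ r 0<λ → ≤√⇒²≤ ℝ 0≤μ (0≤a*b r) (proj₂ isMinimum r 0<λ)))
    (≤-reflexive (*-cong (a-mixture-average ℝ λs x) (b-mixture-average ℝ λs x Σλ≈1)))

  -- This ensures that `√` of the mixed product is a true square root and not the default value 0.
  0≤ab : 0# ≤ a-mixture λs x * b-mixture λs x
  0≤ab = ≤-trans (square-nonNegative μ) μ²≤ab
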